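{- Let $k\ge 2$ and $n_1,\ldots,n_k\ge 2$ be integers. Then \[ \mathrm{gp}(K_{n_1}\,\square\,\cdots\,\square\,K_{n_k})\ge n_1+\cdots+n_k-k . \] Moreover, for $k=2$, $\mathrm{gp}(K_{n_1}\,\square\,K_{n_2})=n_1+n_2-2$.
   Context: Graphs are finite, undirected and simple. $K_n$ is the complete graph on $n$ vertices. The Cartesian product $G\,\square\,H$ has vertex set $V(G)\times V(H)$, and $(g,h)$, $(g',h')$ are adjacent if either $gg'\in E(G)$ and $h=h'$, or $g=g'$ and $hh'\in E(H)$; it is associative up to isomorphism. For a graph $G$, $d_G$ is the shortest-path distance; a $u,v$-geodesic is a $u,v$-path of length $d_G(u,v)$. A set $S\subseteq V(G)$ is a general position set of $G$ if no vertex of $S$ lies on a geodesic between two other vertices of $S$. The general position number $\mathrm{gp}(G)$ is the maximum cardinality of a general position set of $G$. -}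

module Defs where

open import Data.Fin as Fin using (Fin)
import Data.Fin.Properties as Fin
open import Data.Fin.Subset using (Subset; ⊥; ∣_∣) renaming (_∈_ to _∈ˢ_)
open import Data.Fin.Subset.Properties using (anySubset?; ∣p∣≤n; ∉⊥) renaming (_∈?_ to _∈ˢ?_)
open import Data.List as List using (List; []; _∷_)
open import Data.List.Membership.Propositional using (_∈_)
import Data.List.Membership.DecPropositional as DecMembership
open import Data.List.Membership.Propositional.Properties using (∈-lookup)
import Data.List.Relation.Unary.All as All
open import Data.List.Relation.Unary.AllPairs using (_∷_)
open import Data.List.Relation.Unary.Unique.Propositional using (Unique)
import Data.List.Relation.Unary.Unique.DecPropositional as DecUnique
open import Data.Nat using (ℕ; zero; suc; _≤_; _<_; _*_; z≤n; s≤s; s≤s⁻¹; _≤?_)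
open import Data.Nat.Properties
  using (≤-trans; n≤1+n; ≤∧≢⇒<; ≮⇒≥; <⇒≱; n≤0⇒n≡0; _≟_)
open import Data.Product using (Σ-syntax; ∃-syntax; _×_; _,_; proj₁; proj₂)
open import Data.Product.Function.NonDependent.Propositional using (_×-↔_)
open import Data.Sum using (_⊎_; inj₁; inj₂)
open import Data.Vec using (Vec; []; _∷_)
open import Function using (_↔_; Inverse; Injection; _∘_)
open import Function.Construct.Composition using (_↔-∘_)
open import Function.Construct.Identity using (↔-id)
open import Function.Construct.Symmetry using (↔-sym)
open import Function.Properties.Inverse using (↔⇒↣)
open import Level using (0ℓ)
open import Relation.Binary using (Rel; Symmetric; Irreflexive; Decidable; DecidableEquality)
open import Relation.Binary.PropositionalEquality
  using (_≡_; _≢_; refl; sym; cong; subst; ≢-sym)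
open import Relation.Nullary using (¬_; Dec; yes; no; contradiction)
open import Relation.Nullary.Decidable using (map′; ¬?; _×-dec_; _⊎-dec_; _→-dec_; via-injection)
open import Relation.Unary using () renaming (Decidable to Decidable₁)

-- Adjacency is required to be decidable: constructively this is part of being
-- given a finite graph, and it makes gp below a total function.
record Graph : Set₁ where
  infix 4 _~_ _~?_
  field
    Vertex    : Set
    order     : ℕ
    numbering : Vertex ↔ Fin order
    _~_       : Rel Vertex 0ℓ
    ~-sym     : Symmetric _~_
    ~-irrefl  : Irreflexive _≡_ _~_
    _~?_      : Decidable _~_

K : ℕ → Graph
K n = record
  { Vertex    = Fin n
  ; order     = n
  ; numbering = ↔-id (Fin n)
  ; _~_       = _≢_
  ; ~-sym     = ≢-sym
  ; ~-irrefl  = λ x≡y x≢y → x≢y x≡y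
  ; _~?_      = λ x y → ¬? (x Fin.≟ y)
  }

module _ (G : Graph) where
  open Graph G

  vertex-≟ : DecidableEquality Vertex
  vertex-≟ = via-injection (↔⇒↣ numbering) Fin._≟_

  anyVertex? : {P : Vertex → Set} → Decidable₁ P → Dec (Σ[ v ∈ Vertex ] P v)
  anyVertex? {P} P? =
    map′ (λ (i , p) → Inverse.from numbering i , p)
         (λ (v , p) → Inverse.to numbering v ,
                      subst P (sym (Inverse.strictlyInverseʳ numbering v)) p)
         (Fin.any? (P? ∘ Inverse.from numbering))

  allVertices? : {P : Vertex → Set} → Decidable₁ P → Dec (∀ v → P v)
  allVertices? {P} P? =
    map′ (λ f v → subst P (Inverse.strictlyInverseʳ numbering v) (f (Inverse.to numbering v)))
         (λ f i → f (Inverse.from numbering i))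
         (Fin.all? (P? ∘ Inverse.from numbering))

infixr 7 _□_
_□_ : Graph → Graph → Graph
G □ H = record
  { Vertex    = G.Vertex × H.Vertex
  ; order     = G.order * H.order
  ; numbering = ↔-sym (Fin.*↔× {G.order} {H.order}) ↔-∘ (G.numbering ×-↔ H.numbering)
  ; _~_       = λ (g , h) (g′ , h′) → (g G.~ g′ × h ≡ h′) ⊎ (g ≡ g′ × h H.~ h′)
  ; ~-sym     = λ where
      (inj₁ (e , refl)) → inj₁ (G.~-sym e , refl)
      (inj₂ (refl , e)) → inj₂ (refl , H.~-sym e)
  ; ~-irrefl  = λ where
      refl (inj₁ (e , _)) → G.~-irrefl refl e
      refl (inj₂ (_ , e)) → H.~-irrefl refl e
  ; _~?_      = λ (g , h) (g′ , h′) →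
      (g G.~? g′ ×-dec vertex-≟ H h h′) ⊎-dec (vertex-≟ G g g′ ×-dec h H.~? h′)
  }
  where
  module G = Graph G
  module H = Graph H

-- The product is bracketed to the right. The empty product is the one-vertex
-- graph; a single factor is returned unchanged, so that K 1 never enters a
-- product of one or more graphs.
□-product : ∀ {k} → Vec Graph k → Graph
□-product []           = K 1
□-product (G ∷ [])     = G
□-product (G ∷ H ∷ Gs) = G □ □-product (H ∷ Gs)

module _ (G : Graph) where
  open Graph G

  data Walk : Vertex → Vertex → Set where
    []  : ∀ {u} → Walk u u
    _∷_ : ∀ {u v w} → u ~ v → Walk v w → Walk u w

module _ {G : Graph} where
  open Graph G

  length : ∀ {u v} → Walk G u v → ℕ
  length []      = 0
  length (_ ∷ p) = suc (length p)

  vertices : ∀ {u v} → Walk G u v → List Vertex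
  vertices {u} []      = u ∷ []
  vertices {u} (_ ∷ p) = u ∷ vertices p

  IsPath : ∀ {u v} → Walk G u v → Set
  IsPath p = Unique (vertices p)

module _ (G : Graph) where
  open Graph G

  -- Distance is a relation because d(u,v) is not a natural number when u and v
  -- lie in different components.
  IsDistance : Vertex → Vertex → ℕ → Set
  IsDistance u v d =
    (Σ[ p ∈ Walk G u v ] IsPath p × length p ≡ d) ×
    (∀ (q : Walk G u v) → IsPath q → d ≤ length q)

  IsGeodesic : ∀ {u v} → Walk G u v → Set
  IsGeodesic {u} {v} p = IsPath p × IsDistance u v (length p)

  LiesOnGeodesic : Vertex → Vertex → Vertex → Set
  LiesOnGeodesic w u v = Σ[ p ∈ Walk G u v ] IsGeodesic p × w ∈ vertices p

  -- A set of vertices is recorded by the numbers of its members, so that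
  -- ∣_∣ counts its vertices.
  VertexSet : Set
  VertexSet = Subset order

  infix 4 _∈ⱽ_
  _∈ⱽ_ : Vertex → VertexSet → Set
  v ∈ⱽ S = Inverse.to numbering v ∈ˢ S

  IsGeneralPosition : VertexSet → Set
  IsGeneralPosition S =
    ∀ u v w → u ∈ⱽ S → v ∈ⱽ S → w ∈ⱽ S →
    u ≢ v → w ≢ u → w ≢ v → ¬ LiesOnGeodesic w u v

  IsGpNumber : ℕ → Set
  IsGpNumber m =
    (∃[ S ] IsGeneralPosition S × ∣ S ∣ ≡ m) ×
    (∀ S → IsGeneralPosition S → ∣ S ∣ ≤ m)

  private
    length-vertices : ∀ {u v} (p : Walk G u v) → List.length (vertices p) ≡ suc (length p)
    length-vertices []      = refl
    length-vertices (_ ∷ p) = cong suc (length-vertices p)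

    lookup-injective : ∀ {xs : List Vertex} → Unique xs →
                       ∀ i j → List.lookup xs i ≡ List.lookup xs j → i ≡ j
    lookup-injective (_ ∷ _)   Fin.zero    Fin.zero    _  = refl
    lookup-injective (x∉ ∷ _)  Fin.zero    (Fin.suc j) eq = contradiction eq (All.lookup x∉ (∈-lookup j))
    lookup-injective (x∉ ∷ _)  (Fin.suc i) Fin.zero    eq = contradiction (sym eq) (All.lookup x∉ (∈-lookup i))
    lookup-injective (_ ∷ xs!) (Fin.suc i) (Fin.suc j) eq = cong Fin.suc (lookup-injective xs! i j eq)

    unique⇒length≤order : ∀ {xs : List Vertex} → Unique xs → List.length xs ≤ order
    unique⇒length≤order {xs} xs! =
      Fin.injective⇒≤ {f = Inverse.to numbering ∘ List.lookup xs}
        (λ eq → lookup-injective xs! _ _ (Injection.injective (↔⇒↣ numbering) eq))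

    path⇒length≤order : ∀ {u v} (p : Walk G u v) → IsPath p → suc (length p) ≤ order
    path⇒length≤order p p! = subst (_≤ order) (length-vertices p) (unique⇒length≤order p!)

    anyWalk? : (n : ℕ) {P : List Vertex → Set} → Decidable₁ P → ∀ u v →
               Dec (Σ[ p ∈ Walk G u v ] length p ≤ n × P (vertices p))
    anyWalk? n {P} P? u v = map′ to from (stop? ⊎-dec step? n)
      where
      Step : ℕ → Set
      Step n = Σ[ x ∈ Vertex ] (u ~ x × (Σ[ p ∈ Walk G x v ] suc (length p) ≤ n × P (u ∷ vertices p)))

      stop? : Dec (u ≡ v × P (u ∷ []))
      stop? = vertex-≟ G u v ×-dec P? (u ∷ [])

      step? : ∀ n → Dec (Step n)
      step? zero    = no λ { (_ , _ , _ , () , _) }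
      step? (suc n) = anyVertex? G λ x → (u ~? x) ×-dec
        map′ (λ (p , l , Pp) → p , s≤s l , Pp) (λ (p , l , Pp) → p , s≤s⁻¹ l , Pp)
             (anyWalk? n (λ xs → P? (u ∷ xs)) x v)

      to : (u ≡ v × P (u ∷ [])) ⊎ Step n → Σ[ p ∈ Walk G u v ] length p ≤ n × P (vertices p)
      to (inj₁ (refl , Pu))             = [] , z≤n , Pu
      to (inj₂ (_ , e , p , l , Pp))    = e ∷ p , l , Pp

      from : Σ[ p ∈ Walk G u v ] length p ≤ n × P (vertices p) → (u ≡ v × P (u ∷ [])) ⊎ Step n
      from ([]    , _ , Pu) = inj₁ (refl , Pu)
      from (e ∷ p , l , Pp) = inj₂ (_ , e , p , l , Pp)

    path⇒bounded : ∀ {u v} (p : Walk G u v) → IsPath p → length p ≤ order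
    path⇒bounded p p! = ≤-trans (n≤1+n _) (path⇒length≤order p p!)

    noShorter? : ∀ u v n → Dec (∀ (q : Walk G u v) → IsPath q → n ≤ suc (length q))
    noShorter? u v n = map′ to from (¬? (anyWalk? order shortPath? u v))
      where
      ShortPath : List Vertex → Set
      ShortPath xs = Unique xs × List.length xs < n

      shortPath? : Decidable₁ ShortPath
      shortPath? xs = DecUnique.unique? (vertex-≟ G) xs ×-dec suc (List.length xs) ≤? n

      to : ¬ (Σ[ q ∈ Walk G u v ] length q ≤ order × ShortPath (vertices q)) →
           ∀ (q : Walk G u v) → IsPath q → n ≤ suc (length q)
      to none q q! = ≮⇒≥ λ lt →
        none (q , path⇒bounded q q! , q! , subst (_< n) (sym (length-vertices q)) lt)

      from : (∀ (q : Walk G u v) → IsPath q → n ≤ suc (length q)) →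
             ¬ (Σ[ q ∈ Walk G u v ] length q ≤ order × ShortPath (vertices q))
      from all (q , _ , q! , lt) = <⇒≱ (subst (_< n) (length-vertices q) lt) (all q q!)

  liesOnGeodesic? : ∀ w u v → Dec (LiesOnGeodesic w u v)
  liesOnGeodesic? w u v = map′ to from (anyWalk? order shortestThrough? u v)
    where
    ShortestThrough : List Vertex → Set
    ShortestThrough xs =
      Unique xs ×
      (∀ (q : Walk G u v) → IsPath q → List.length xs ≤ suc (length q)) ×
      w ∈ xs

    shortestThrough? : Decidable₁ ShortestThrough
    shortestThrough? xs =
      DecUnique.unique? (vertex-≟ G) xs ×-dec
      noShorter? u v (List.length xs) ×-dec
      DecMembership._∈?_ (vertex-≟ G) w xs

    to : Σ[ p ∈ Walk G u v ] length p ≤ order × ShortestThrough (vertices p) →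
         LiesOnGeodesic w u v
    to (p , _ , p! , short , w∈p) =
      p , (p! , (p , p! , refl) ,
           λ q q! → s≤s⁻¹ (subst (_≤ suc (length q)) (length-vertices p) (short q q!))) , w∈p

    from : LiesOnGeodesic w u v →
           Σ[ p ∈ Walk G u v ] length p ≤ order × ShortestThrough (vertices p)
    from (p , (p! , _ , short) , w∈p) =
      p , path⇒bounded p p! , p! ,
      (λ q q! → subst (_≤ suc (length q)) (sym (length-vertices p)) (s≤s (short q q!))) , w∈p

  isGeneralPosition? : Decidable₁ IsGeneralPosition
  isGeneralPosition? S =
    allVertices? G λ u → allVertices? G λ v → allVertices? G λ w →
      member? u →-dec member? v →-dec member? w →-dec
      ¬? (vertex-≟ G u v) →-dec ¬? (vertex-≟ G w u) →-dec ¬? (vertex-≟ G w v) →-dec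
      ¬? (liesOnGeodesic? w u v)
    where
    member? : ∀ v → Dec (v ∈ⱽ S)
    member? v = Inverse.to numbering v ∈ˢ? S

  private
    search : ∀ m → (∀ S → IsGeneralPosition S → ∣ S ∣ ≤ m) → ∃[ n ] IsGpNumber n
    search m bound with anySubset? (λ S → isGeneralPosition? S ×-dec (∣ S ∣ ≟ m))
    search m       bound | yes found = m , found , bound
    search zero    bound | no none   =
      contradiction (⊥ , ⊥-general , n≤0⇒n≡0 (bound ⊥ ⊥-general)) none
      where
      ⊥-general : IsGeneralPosition ⊥
      ⊥-general _ _ _ u∈⊥ = contradiction u∈⊥ ∉⊥
    search (suc m) bound | no none   =
      search m λ S gen → s≤s⁻¹ (≤∧≢⇒< (bound S gen) λ eq → none (S , gen , eq))

  gpNumber-exists : ∃[ m ] IsGpNumber m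
  gpNumber-exists = search order λ S _ → ∣p∣≤n S

  gp : ℕ
  gp = proj₁ gpNumber-exists

  gp-isGpNumber : IsGpNumber gp
  gp-isGpNumber = proj₂ gpNumber-exists

{-# OPTIONS --safe #-}

-- Lower bound: fix an origin in every factor and take the vertices that differ
-- from the origin in exactly one coordinate. Each is adjacent to the origin, so
-- they are pairwise at distance at most two, and adjacency among them (lying on
-- the same axis) is transitive; hence no member is the midpoint of a geodesic
-- between two others.
--
-- Upper bound for two factors: a member sharing its row with one member and its
-- column with another would be the midpoint of a geodesic between them. So every
-- member can be labelled injectively by its row, if it is alone there, or else
-- by its column. If every member is alone in its row, or every member alone in
-- its column, the bound is immediate; otherwise some row and some column are
-- never used as labels.
module Submission where

open import Defs
open import Data.Nat using (ℕ; _+_; _∸_; _≤_; _≥_)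
open import Data.Product using (_×_)
open import Data.Vec using (Vec; map; sum)
open import Data.Vec.Relation.Unary.All using (All)
open import Relation.Binary.PropositionalEquality using (_≡_)

open import Data.Fin using (Fin; zero; suc; punchOut; join)
open import Data.Fin.Properties as Fin using (_≟_; any?; injective⇒≤; punchOut-injective; +↔⊎)
open import Data.Fin.Subset using (Subset; inside; outside; ∣_∣; _∈_)
open import Data.List.Relation.Unary.Any using (here; there)
open import Data.List.Relation.Unary.All using ([]; _∷_)
open import Data.List.Relation.Unary.AllPairs using ([]; _∷_)
open import Data.Nat using (zero; suc; s≤s; z≤n)
open import Data.Nat.Properties
  using (≤-antisym; ≤-reflexive; ≤-trans; <⇒≤; +-mono-≤; +-suc; +-∸-assoc;
         m≤m+n; m≤n+m; +-identityʳ; +-monoʳ-≤; +-comm)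
open import Data.Product using (∃-syntax; _,_; proj₁; proj₂)
open import Data.Sum using (_⊎_; inj₁; inj₂)
open import Data.Sum.Properties using (inj₁-injective; inj₂-injective)
open import Data.Vec using ([]; _∷_; here; there; tabulate)
open import Data.Vec.Properties using ([]=⇒lookup; lookup⇒[]=; lookup∘tabulate)
open import Data.Vec.Relation.Unary.All as All using ([]; _∷_)
open import Function using (_∘_; Inverse; Injection; _↣_)
open import Function.Definitions using (Injective)
open import Function.Properties.Inverse using (↔⇒↣; ↔-sym)
open import Relation.Binary.PropositionalEquality
  using (_≢_; refl; sym; trans; cong; cong₂; subst; ≢-sym)
open import Relation.Nullary using (¬_; Dec; yes; no; does; contradiction; decidable-stable)
open import Relation.Nullary.Decidable using (¬?; _×-dec_; dec-true)

-- Cardinality of finite subsets through injections.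

-- Maps into `Fin ∣ S ∣` give lower bounds on the cardinality; `member` goes the other way and gives
-- upper bounds.
rank : ∀ {n} (S : Subset n) {x : Fin n} → x ∈ S → Fin ∣ S ∣
rank (inside  ∷ S) here        = zero
rank (inside  ∷ S) (there x∈S) = suc (rank S x∈S)
rank (outside ∷ S) (there x∈S) = rank S x∈S

rank-injective : ∀ {n} (S : Subset n) {x y : Fin n} (x∈S : x ∈ S) (y∈S : y ∈ S) →
                 rank S x∈S ≡ rank S y∈S → x ≡ y
rank-injective (inside  ∷ S) here        here        _  = refl
rank-injective (inside  ∷ S) (there x∈S) (there y∈S) eq =
  cong suc (rank-injective S x∈S y∈S (Fin.suc-injective eq))
rank-injective (outside ∷ S) (there x∈S) (there y∈S) eq =
  cong suc (rank-injective S x∈S y∈S eq)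

member : ∀ {n} (S : Subset n) → Fin ∣ S ∣ → Fin n
member (inside  ∷ S) zero    = zero
member (inside  ∷ S) (suc i) = suc (member S i)
member (outside ∷ S) i       = suc (member S i)

member-∈ : ∀ {n} (S : Subset n) (i : Fin ∣ S ∣) → member S i ∈ S
member-∈ (inside  ∷ S) zero    = here
member-∈ (inside  ∷ S) (suc i) = there (member-∈ S i)
member-∈ (outside ∷ S) i       = there (member-∈ S i)

member-injective : ∀ {n} (S : Subset n) → Injective _≡_ _≡_ (member S)
member-injective (inside  ∷ S) {zero}  {zero}  _  = refl
member-injective (inside  ∷ S) {suc i} {suc j} eq =
  cong suc (member-injective S (Fin.suc-injective eq))
member-injective (outside ∷ S) eq = member-injective S (Fin.suc-injective eq)

image : ∀ {m n} → (Fin m → Fin n) → Subset n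
image f = tabulate λ x → does (any? λ i → f i ≟ x)

∈-image : ∀ {m n} (f : Fin m → Fin n) (i : Fin m) → f i ∈ image f
∈-image f i = lookup⇒[]= (f i) (image f)
  (trans (lookup∘tabulate _ (f i)) (dec-true (any? λ j → f j ≟ f i) (i , refl)))

image-∈ : ∀ {m n} (f : Fin m → Fin n) {x : Fin n} → x ∈ image f → ∃[ i ] f i ≡ x
image-∈ f {x} x∈ with any? (λ i → f i ≟ x) | trans (sym (lookup∘tabulate _ x)) ([]=⇒lookup x∈)
... | yes found | _  = found
... | no  _     | ()

∣image∣≥ : ∀ {m n} (f : Fin m → Fin n) → Injective _≡_ _≡_ f → m ≤ ∣ image f ∣
∣image∣≥ f f-inj = injective⇒≤ {f = λ i → rank (image f) (∈-image f i)}
  (f-inj ∘ rank-injective (image f) (∈-image f _) (∈-image f _))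

-- Fans.

-- Abstracts the vertices that differ from an origin in one coordinate, keeping just what general
-- position uses and what passes to products. The condition `i ≢ l` is forced by irreflexivity of
-- adjacency.
record Fan (G : Graph) (I : Set) : Set where
  open Graph G
  field
    hub             : Vertex
    spoke           : I → Vertex
    spoke-injective : Injective _≡_ _≡_ spoke
    hub~spoke       : ∀ i → hub ~ spoke i
    ~-transitive    : ∀ {i j l} → i ≢ l → spoke i ~ spoke j → spoke j ~ spoke l →
                      spoke i ~ spoke l

reindex : ∀ {G I J} → J ↣ I → Fan G I → Fan G J
reindex J↣I F = record
  { hub             = hub
  ; spoke           = spoke ∘ to
  ; spoke-injective = injective ∘ spoke-injective
  ; hub~spoke       = hub~spoke ∘ to
  ; ~-transitive    = λ i≢l → ~-transitive (i≢l ∘ injective)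
  }
  where
  open Fan F
  open Injection J↣I

K-fan : ∀ n → Fan (K (suc n)) (Fin n)
K-fan n = record
  { hub             = zero
  ; spoke           = suc
  ; spoke-injective = Fin.suc-injective
  ; hub~spoke       = λ _ ()
  ; ~-transitive    = λ i≢l _ _ → i≢l ∘ Fin.suc-injective
  }

-- Geodesics of length at most two, and general position of fans.

module _ {G : Graph} where
  open Graph G

  ~⇒≢ : ∀ {u v} → u ~ v → u ≢ v
  ~⇒≢ u~v u≡v = ~-irrefl u≡v u~v

  edge-isPath : ∀ {u v} (u~v : u ~ v) → IsPath {G} (u~v ∷ [])
  edge-isPath u~v = (~⇒≢ u~v ∷ []) ∷ [] ∷ []

  two-edges-isPath : ∀ {u w v} (u~w : u ~ w) (w~v : w ~ v) → u ≢ v →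
                     IsPath {G} (u~w ∷ w~v ∷ [])
  two-edges-isPath u~w w~v u≢v = (~⇒≢ u~w ∷ u≢v ∷ []) ∷ (~⇒≢ w~v ∷ []) ∷ [] ∷ []

  -- Two vertices with a common neighbour are at distance at most two.
  between⇒midpoint : ∀ {u v w o} → u ~ o → o ~ v → u ≢ v → w ≢ u → w ≢ v →
                     LiesOnGeodesic G w u v → ¬ u ~ v × u ~ w × w ~ v
  between⇒midpoint _ _ u≢v _ _ ([] , _) = contradiction refl u≢v
  between⇒midpoint _ _ _ w≢u _ (_ ∷ [] , _ , here w≡u) = contradiction w≡u w≢u
  between⇒midpoint _ _ _ _ w≢v (_ ∷ [] , _ , there (here w≡v)) = contradiction w≡v w≢v
  between⇒midpoint _ _ _ w≢u _ (_ ∷ _ ∷ [] , _ , here w≡u) = contradiction w≡u w≢u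
  between⇒midpoint _ _ _ _ _ (e ∷ e′ ∷ [] , (_ , _ , shortest) , there (here refl)) =
    (λ u~v → contradiction (shortest (u~v ∷ []) (edge-isPath u~v)) λ { (s≤s ()) }) , e , e′
  between⇒midpoint _ _ _ _ w≢v (_ ∷ _ ∷ [] , _ , there (there (here w≡v))) =
    contradiction w≡v w≢v
  between⇒midpoint u~o o~v u≢v _ _ (_ ∷ _ ∷ _ ∷ _ , (_ , _ , shortest) , _) =
    contradiction (shortest (u~o ∷ o~v ∷ []) (two-edges-isPath u~o o~v u≢v))
                  λ { (s≤s (s≤s ())) }

  midpoint⇒between : ∀ {u v w} → u ≢ v → ¬ u ~ v → u ~ w → w ~ v → LiesOnGeodesic G w u v
  midpoint⇒between {u} {v} u≢v u≁v u~w w~v =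
    p , (path , (p , path , refl) , λ q _ → shortest q) , there (here refl)
    where
    p : Walk G u v
    p = u~w ∷ w~v ∷ []
    path : IsPath p
    path = two-edges-isPath u~w w~v u≢v
    shortest : (q : Walk G u v) → 2 ≤ length q
    shortest []          = contradiction refl u≢v
    shortest (u~v ∷ [])  = contradiction u~v u≁v
    shortest (_ ∷ _ ∷ _) = s≤s (s≤s z≤n)

  gp≤ : ∀ {m} → (∀ S → IsGeneralPosition G S → ∣ S ∣ ≤ m) → gp G ≤ m
  gp≤ bound = let S , general , ∣S∣≡gp = proj₁ (gp-isGpNumber G)
              in subst (_≤ _) ∣S∣≡gp (bound S general)

  -- The hub is a common neighbour of all spokes, so a spoke on a geodesic between two others is its
  -- midpoint; transitivity then makes the ends adjacent, a contradiction.
  Fan⇒gp≥ : ∀ {m} → Fan G (Fin m) → gp G ≥ m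
  Fan⇒gp≥ {m} F =
    ≤-trans (∣image∣≥ code (spoke-injective ∘ number-injective))
            (proj₂ (gp-isGpNumber G) (image code) general)
    where
    open Fan F
    open Injection (↔⇒↣ numbering)
      using () renaming (to to number; injective to number-injective)

    code : Fin m → Fin order
    code = number ∘ spoke

    general : IsGeneralPosition G (image code)
    general u v w u∈ v∈ w∈ with image-∈ code u∈ | image-∈ code v∈ | image-∈ code w∈
    ... | i , eqᵢ | j , eqⱼ | l , eqₗ
      with refl ← number-injective eqᵢ | refl ← number-injective eqⱼ | refl ← number-injective eqₗ
      = λ u≢v w≢u w≢v onGeodesic →
        let u≁v , u~w , w~v = between⇒midpoint (~-sym (hub~spoke i)) (hub~spoke j)
                                u≢v w≢u w≢v onGeodesic
        in u≁v (~-transitive (u≢v ∘ cong spoke) u~w w~v)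

-- Fans in Cartesian products.

module _ {G H : Graph} {I J : Set} (F : Fan G I) (F′ : Fan H J) where
  private
    module F  = Fan F
    module F′ = Fan F′
    module GH = Graph (G □ H)

    axis : I ⊎ J → GH.Vertex
    axis (inj₁ i) = F.spoke i , F′.hub
    axis (inj₂ j) = F.hub , F′.spoke j

    spoke≢hub : ∀ i → F.spoke i ≢ F.hub
    spoke≢hub i = ≢-sym (~⇒≢ {G} (F.hub~spoke i))

    spoke≢hub′ : ∀ j → F′.spoke j ≢ F′.hub
    spoke≢hub′ j = ≢-sym (~⇒≢ {H} (F′.hub~spoke j))

    axis-injective : Injective _≡_ _≡_ axis
    axis-injective {inj₁ i} {inj₁ _} eq = cong inj₁ (F.spoke-injective (cong proj₁ eq))
    axis-injective {inj₁ i} {inj₂ _} eq = contradiction (cong proj₁ eq) (spoke≢hub i)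
    axis-injective {inj₂ _} {inj₁ i} eq = contradiction (cong proj₁ (sym eq)) (spoke≢hub i)
    axis-injective {inj₂ _} {inj₂ j} eq = cong inj₂ (F′.spoke-injective (cong proj₂ eq))

    hub~axis : ∀ x → (F.hub , F′.hub) GH.~ axis x
    hub~axis (inj₁ i) = inj₁ (F.hub~spoke i , refl)
    hub~axis (inj₂ j) = inj₂ (refl , F′.hub~spoke j)

    -- Adjacent vertices of a product agree in one coordinate, but here each coordinate compares a
    -- spoke with a hub. Transitivity therefore only has to be checked within one factor.
    axes-apart : ∀ i j → ¬ axis (inj₁ i) GH.~ axis (inj₂ j)
    axes-apart i j (inj₁ (_ , eq)) = spoke≢hub′ j (sym eq)
    axes-apart i j (inj₂ (eq , _)) = spoke≢hub i eq

    within₁ : ∀ {i l} → axis (inj₁ i) GH.~ axis (inj₁ l) → Graph._~_ G (F.spoke i) (F.spoke l)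
    within₁ (inj₁ (e , _)) = e
    within₁ (inj₂ (_ , e)) = contradiction refl (~⇒≢ {H} e)

    within₂ : ∀ {j l} → axis (inj₂ j) GH.~ axis (inj₂ l) → Graph._~_ H (F′.spoke j) (F′.spoke l)
    within₂ (inj₁ (e , _)) = contradiction refl (~⇒≢ {G} e)
    within₂ (inj₂ (_ , e)) = e

    axis-~-transitive : ∀ {x y z} → x ≢ z → axis x GH.~ axis y → axis y GH.~ axis z →
                        axis x GH.~ axis z
    axis-~-transitive {inj₁ _} {inj₁ _} {inj₁ _} x≢z e e′ =
      inj₁ (F.~-transitive (x≢z ∘ cong inj₁) (within₁ e) (within₁ e′) , refl)
    axis-~-transitive {inj₂ _} {inj₂ _} {inj₂ _} x≢z e e′ =
      inj₂ (refl , F′.~-transitive (x≢z ∘ cong inj₂) (within₂ e) (within₂ e′))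
    axis-~-transitive {inj₁ i} {inj₂ j} _ e _ = contradiction e (axes-apart i j)
    axis-~-transitive {inj₂ j} {inj₁ i} _ e _ = contradiction (GH.~-sym e) (axes-apart i j)
    axis-~-transitive {inj₁ _} {inj₁ i} {inj₂ j} _ _ e = contradiction e (axes-apart i j)
    axis-~-transitive {inj₂ _} {inj₂ j} {inj₁ i} _ _ e =
      contradiction (GH.~-sym e) (axes-apart i j)

  □-fan : Fan (G □ H) (I ⊎ J)
  □-fan = record
    { hub             = F.hub , F′.hub
    ; spoke           = axis
    ; spoke-injective = axis-injective
    ; hub~spoke       = hub~axis
    ; ~-transitive    = λ {i} {j} {l} → axis-~-transitive {i} {j} {l}
    }

-- Keeps truncated subtraction exact when a factor is split off the product.
length≤sum : ∀ {k} {ns : Vec ℕ k} → All (_≥ 1) ns → k ≤ sum ns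
length≤sum []           = z≤n
length≤sum (n≥1 ∷ ns≥1) = +-mono-≤ n≥1 (length≤sum ns≥1)

-- Each factor contributes all its vertices but the hub, hence the loss of one per factor.
□-product-fan : ∀ {k} {ns : Vec ℕ (suc k)} → All (_≥ 1) ns →
                Fan (□-product (map K ns)) (Fin (sum ns ∸ suc k))
□-product-fan {ns = suc n ∷ []} (s≤s _ ∷ []) =
  subst (Fan (K (suc n)) ∘ Fin) (sym (+-identityʳ n)) (K-fan n)
□-product-fan {suc k} {suc n ∷ ms@(_ ∷ _)} (s≤s _ ∷ ms≥1) =
  subst (Fan (□-product (map K (suc n ∷ ms))) ∘ Fin) (sym (+-∸-assoc n (length≤sum ms≥1)))
    (reindex (↔⇒↣ (+↔⊎ {n})) (□-fan (K-fan n) (□-product-fan ms≥1)))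

-- Upper bound for two factors.

Shared : ∀ {N} {A : Set} → (Fin N → A) → Fin N → Set
Shared f i = ∃[ j ] j ≢ i × f j ≡ f i

shared? : ∀ {N n} (f : Fin N → Fin n) (i : Fin N) → Dec (Shared f i)
shared? f i = any? λ j → ¬? (j ≟ i) ×-dec f j ≟ f i

shared-resp : ∀ {N} {A : Set} (f : Fin N → A) {i j} → f i ≡ f j → Shared f i → Shared f j
shared-resp f {i} {j} eq shared with i ≟ j
... | yes refl = shared
... | no  i≢j  = i , i≢j , eq

unshared-injective : ∀ {N} {A : Set} (f : Fin N → A) {i j} → ¬ Shared f j → f i ≡ f j → i ≡ j
unshared-injective f {i} {j} unshared eq =
  decidable-stable (i ≟ j) λ i≢j → unshared (i , i≢j , eq)

noCorner⇒≤ : ∀ {N m n} (row : Fin N → Fin (2 + m)) (col : Fin N → Fin (2 + n)) →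
             (∀ i → Shared row i → ¬ Shared col i) → N ≤ (2 + m) + (2 + n) ∸ 2
noCorner⇒≤ {N} {m} {n} row col noCorner with any? (shared? row) | any? (shared? col)
-- With no shared row, `row` is injective and N ≤ 2 + m; the other side has length at least 2, which
-- makes up for the subtracted 2.
... | no none | _ = ≤-trans
  (injective⇒≤ {f = row} (unshared-injective row λ s → none (_ , s)))
  (≤-trans (≤-reflexive (+-comm 2 m)) (+-monoʳ-≤ m (m≤m+n 2 n)))
... | _ | no none = ≤-trans
  (injective⇒≤ {f = col} (unshared-injective col λ s → none (_ , s)))
  (m≤n+m (2 + n) m)
-- The row of `i₀` and the column of `j₀` never serve as labels; punching them out leaves `suc m`
-- and `suc n` values.
... | yes (i₀ , sharedRow) | yes (j₀ , sharedCol) = ≤-trans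
  (injective⇒≤ {f = join (suc m) (suc n) ∘ label} (label-injective ∘ join-injective))
  (≤-reflexive (sym (+-suc m (suc n))))
  where
  row≢ : ∀ {i} → ¬ Shared row i → row i₀ ≢ row i
  row≢ unshared eq = unshared (shared-resp row eq sharedRow)

  -- A point labelled by its column shares its row, so `noCorner` makes it alone in its column,
  -- while the column of `j₀` holds two points.
  col≢ : ∀ {i} → Shared row i → col j₀ ≢ col i
  col≢ {i} shared eq = noCorner i shared (shared-resp col eq sharedCol)

  label : Fin N → Fin (suc m) ⊎ Fin (suc n)
  label i with shared? row i
  ... | yes shared   = inj₂ (punchOut (col≢ shared))
  ... | no  unshared = inj₁ (punchOut (row≢ unshared))

  label-injective : Injective _≡_ _≡_ label
  label-injective {i} {j} eq with shared? row i | shared? row j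
  label-injective eq | yes s | yes s′ = unshared-injective col (noCorner _ s′)
    (punchOut-injective (col≢ s) (col≢ s′) (inj₂-injective eq))
  label-injective eq | no u | no u′ = unshared-injective row u′
    (punchOut-injective (row≢ u) (row≢ u′) (inj₁-injective eq))

  join-injective : Injective _≡_ _≡_ (join (suc m) (suc n))
  join-injective = Injection.injective (↔⇒↣ (↔-sym (+↔⊎ {suc m} {suc n})))

generalPosition⇒∣S∣≤ : ∀ {n₁ n₂} → n₁ ≥ 2 → n₂ ≥ 2 → (S : VertexSet (K n₁ □ K n₂)) →
                       IsGeneralPosition (K n₁ □ K n₂) S → ∣ S ∣ ≤ n₁ + n₂ ∸ 2
generalPosition⇒∣S∣≤ {suc (suc m)} {suc (suc n)} (s≤s (s≤s _)) (s≤s (s≤s _)) S general =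
  noCorner⇒≤ (proj₁ ∘ vertex) (proj₂ ∘ vertex) noCorner
  where
  P = K (2 + m) □ K (2 + n)
  open Graph P

  vertex : Fin ∣ S ∣ → Vertex
  vertex = Inverse.from numbering ∘ member S

  vertex-injective : Injective _≡_ _≡_ vertex
  vertex-injective =
    member-injective S ∘ Injection.injective (↔⇒↣ (↔-sym numbering))

  vertex-∈ : ∀ i → _∈ⱽ_ P (vertex i) S
  vertex-∈ i = subst (_∈ S) (sym (Inverse.strictlyInverseˡ numbering (member S i))) (member-∈ S i)

  -- The row mate `vertex j` and the column mate `vertex l` are both adjacent to `vertex i`.
  -- Agreeing in a coordinate would make one of them equal to `vertex i`, so they are distinct and
  -- non-adjacent, with `vertex i` as midpoint.
  noCorner : ∀ i → Shared (proj₁ ∘ vertex) i → ¬ Shared (proj₂ ∘ vertex) i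
  noCorner i (j , j≢i , row≡) (l , l≢i , col≡) =
    general (vertex j) (vertex l) (vertex i) (vertex-∈ j) (vertex-∈ l) (vertex-∈ i)
      vj≢vl (j≢i ∘ sym ∘ vertex-injective) (l≢i ∘ sym ∘ vertex-injective)
      (midpoint⇒between vj≢vl vj≁vl
        (inj₂ (row≡ , λ col≡′ → j≢i (vertex-injective (cong₂ _,_ row≡ col≡′))))
        (inj₁ ((λ row≡′ → l≢i (vertex-injective (cong₂ _,_ (sym row≡′) col≡))) , sym col≡)))
    where
    vj≢vl : vertex j ≢ vertex l
    vj≢vl eq = j≢i (vertex-injective (cong₂ _,_ row≡ (trans (cong proj₂ eq) col≡)))

    vj≁vl : ¬ vertex j ~ vertex l
    vj≁vl (inj₁ (_ , eq)) = j≢i (vertex-injective (cong₂ _,_ row≡ (trans eq col≡)))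
    vj≁vl (inj₂ (eq , _)) = l≢i (vertex-injective (cong₂ _,_ (trans (sym eq) row≡) col≡))

theorem3p2 : (∀ (k : ℕ) → k ≥ 2 → (ns : Vec ℕ k) → All (_≥ 2) ns →
    gp (□-product (map K ns)) ≥ sum ns ∸ k) ×
    (∀ (n₁ n₂ : ℕ) → n₁ ≥ 2 → n₂ ≥ 2 →
    gp (K n₁ □ K n₂) ≡ n₁ + n₂ ∸ 2)
theorem3p2 =
  (λ { (suc _) _ ns ns≥2 →
       Fan⇒gp≥ {G = □-product (map K ns)} (□-product-fan (All.map <⇒≤ ns≥2)) }) ,
  λ n₁ n₂ n₁≥2 n₂≥2 → ≤-antisym
    (gp≤ {G = K n₁ □ K n₂} (generalPosition⇒∣S∣≤ n₁≥2 n₂≥2))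
    -- The sum of the two-entry vector unfolds to `n₁ + (n₂ + 0)`.
    (subst (λ s → gp (K n₁ □ K n₂) ≥ n₁ + s ∸ 2) (+-identityʳ n₂)
      (Fan⇒gp≥ {G = K n₁ □ K n₂}
        (□-product-fan {ns = n₁ ∷ n₂ ∷ []} (<⇒≤ n₁≥2 ∷ <⇒≤ n₂≥2 ∷ []))))
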